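{- Let $q$ be a prime power, $m,l,k$ integers with $3\le k\le\min\{m+1,l\}$, and $1\le r\le k-1$. Let $\langle 1,u_1,\dots,u_r\rangle$ and $\langle 1,u_1',\dots,u_r'\rangle$ be two $(r+1)$-dimensional $\mathrm{GF}(q)$-subspaces of $\mathrm{GF}(q^l)$. Then the $G$-orbit $T(u_1,\dots,u_r)^G$ contains $T(u_1',\dots,u_r')$ if and only if the $H$-orbit $\langle 1,u_1,\dots,u_r\rangle^H$ contains $\langle 1,u_1',\dots,u_r'\rangle$.
   Context: $V$ is an $m$-dimensional vector space over $\mathrm{GF}(q^l)$ with basis $Y_1,\dots,Y_m$, regarded also as an $ml$-dimensional space over $\mathrm{GF}(q)$. $G=\mathrm{GL}(m,q^l)$ acts $\mathrm{GF}(q^l)$-linearly on $V$ and hence on its $\mathrm{GF}(q)$-subspaces; $W^G=\{g(W):g\in G\}$. $H$ is a Singer cycle of $\mathrm{GF}(q^l)$, i.e. the group of multiplications by elements of $\mathrm{GF}(q^l)^*$, acting on the $\mathrm{GF}(q)$-subspaces of $\mathrm{GF}(q^l)$; $W^H$ denotes the $H$-orbit of $W$. $\langle\cdot\rangle$ denotes $\mathrm{GF}(q)$-span. For $u_1,\dots,u_r\in\mathrm{GF}(q^l)$ with $1,u_1,\dots,u_r$ linearly independent over $\mathrm{GF}(q)$, $$T(u_1,\dots,u_r)=\langle Y_1,\dots,Y_{k-1},\,u_1Y_1+\cdots+u_rY_r\rangle,$$ a $k$-dimensional $\mathrm{GF}(q)$-subspace of $V$. -}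

module Defs where

open import Algebra.Apartness.Bundles using (HeytingField; HeytingCommutativeRing)
open import Algebra.Bundles using (Ring; CommutativeRing)
import Algebra.Definitions.RawMonoid as RawSum
open import Algebra.Module.Bundles using (LeftModule)
open import Algebra.Module.Morphism.Structures using (IsLeftModuleIsomorphism)
import Algebra.Module.Construct.TensorUnit as TensorUnit
open import Algebra.Morphism.Structures using (module RingMorphisms)
open import Data.Fin.Base using (Fin; inject≤)
open import Data.Nat.Base using (ℕ; _+_; _∸_; _^_; _≤_)
open import Data.Nat.Primality using (Prime)
open import Data.Nat.Properties using (≤-trans; m≤n+o⇒m∸n≤o; +-comm; ≤-reflexive)
open import Data.Product.Base using (Σ-syntax; ∃-syntax; _×_)
open import Data.Vec.Functional using (Vector; _∷_; []; _++_)
open import Function.Base using (_∘_)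
open import Function.Bundles using (Inverse)
open import Level using (Level; _⊔_; suc)
open import Relation.Binary.Bundles using (Setoid)
import Relation.Binary.PropositionalEquality.Properties as ≡
open import Relation.Binary.PropositionalEquality.Core using (_≡_)
open import Relation.Unary using (Pred; _∈_; _≐_)

private
  variable
    a b c ℓ ℓ₁ ℓ₂ c′ ℓ′ : Level

IsPrimePower : ℕ → Set
IsPrimePower q = ∃[ p ] ∃[ e ] (Prime p × 1 ≤ e × q ≡ p ^ e)

-- GF(q) is unique only up to isomorphism, so it is represented by an arbitrary
-- field whose elements, up to _≈_, are enumerated by Fin q.  The enumeration
-- makes _≈_ decidable, and then _#_ coincides with the negation of _≈_.

record FiniteField (q : ℕ) c ℓ₁ ℓ₂ : Set (suc (c ⊔ ℓ₁ ⊔ ℓ₂)) where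
  field
    heytingField : HeytingField c ℓ₁ ℓ₂

  open HeytingField heytingField public

  commutativeRing : CommutativeRing c ℓ₁
  commutativeRing = HeytingCommutativeRing.commutativeRing heytingCommutativeRing

  open CommutativeRing commutativeRing public
    using (ring; rawRing)

  field
    enumeration : Inverse setoid (≡.setoid (Fin q))

module _ {R : Ring c ℓ} (M : LeftModule R a b) where
  open Ring R using (Carrier; _≈_; 0#)
  open LeftModule M
  open RawSum +ᴹ-rawMonoid using (sum)

  linearCombination : ∀ {n} → Vector Carrier n → Vector Carrierᴹ n → Carrierᴹ
  linearCombination x v = sum (λ i → x i *ₗ v i)

  Span : ∀ {n} → Vector Carrierᴹ n → Pred Carrierᴹ (c ⊔ b)
  Span {n} v w = Σ[ x ∈ Vector Carrier n ] w ≈ᴹ linearCombination x v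

  LinearlyIndependent : ∀ {n} → Vector Carrierᴹ n → Set (c ⊔ ℓ ⊔ b)
  LinearlyIndependent v = ∀ x → linearCombination x v ≈ᴹ 0ᴹ → ∀ i → x i ≈ 0#

  IsBasis : ∀ {n} → Vector Carrierᴹ n → Set (c ⊔ ℓ ⊔ a ⊔ b)
  IsBasis v = LinearlyIndependent v × (∀ w → w ∈ Span v)

  -- The transformations of M forming its general linear group.
  GL : Pred (Carrierᴹ → Carrierᴹ) (c ⊔ a ⊔ b)
  GL = IsLeftModuleIsomorphism rawLeftModule rawLeftModule

module _ (S : Setoid a b) where
  open Setoid S

  Image : (Carrier → Carrier) → Pred Carrier ℓ → Pred Carrier (a ⊔ b ⊔ ℓ)
  Image g W y = ∃[ x ] (x ∈ W × y ≈ g x)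

  -- Orbit G W is { g(W) ∣ g ∈ G }, subsets being compared extensionally.
  Orbit : Pred (Carrier → Carrier) ℓ → Pred Carrier ℓ₁ →
          Pred (Pred Carrier ℓ₂) (a ⊔ b ⊔ ℓ ⊔ ℓ₁ ⊔ ℓ₂)
  Orbit G W W′ = ∃[ g ] (g ∈ G × Image g W ≐ W′)

module _ {q : ℕ} (L : FiniteField q c ℓ₁ ℓ₂) where
  open FiniteField L

  SingerCycle : Pred (Carrier → Carrier) (c ⊔ ℓ₁ ⊔ ℓ₂)
  SingerCycle h = ∃[ s ] (s # 0# × (∀ x → h x ≈ s * x))

module _ (R : Ring c ℓ) (S : Ring c′ ℓ′) where
  private
    module R = Ring R
    module S = Ring S
  open RingMorphisms R.rawRing S.rawRing

  restrictScalars : (ι : R.Carrier → S.Carrier) → IsRingHomomorphism ι →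
                    LeftModule S a b → LeftModule R a b
  restrictScalars ι ι-homo M = record
    { Carrierᴹ = Carrierᴹ
    ; _≈ᴹ_ = _≈ᴹ_
    ; _+ᴹ_ = _+ᴹ_
    ; _*ₗ_ = λ x v → ι x *ₗ v
    ; 0ᴹ = 0ᴹ
    ; -ᴹ_ = -ᴹ_
    ; isLeftModule = record
      { isLeftSemimodule = record
        { +ᴹ-isCommutativeMonoid = +ᴹ-isCommutativeMonoid
        ; isPreleftSemimodule = record
          { *ₗ-cong = λ p r → *ₗ-cong (⟦⟧-cong p) r
          ; *ₗ-zeroˡ = λ v → ≈ᴹ-trans (*ₗ-cong 0#-homo ≈ᴹ-refl) (*ₗ-zeroˡ v)
          ; *ₗ-distribʳ = λ v x y →
              ≈ᴹ-trans (*ₗ-cong (+-homo x y) ≈ᴹ-refl) (*ₗ-distribʳ v (ι x) (ι y))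
          ; *ₗ-identityˡ = λ v →
              ≈ᴹ-trans (*ₗ-cong 1#-homo ≈ᴹ-refl) (*ₗ-identityˡ v)
          ; *ₗ-assoc = λ x y v →
              ≈ᴹ-trans (*ₗ-cong (*-homo x y) ≈ᴹ-refl) (*ₗ-assoc (ι x) (ι y) v)
          ; *ₗ-zeroʳ = λ x → *ₗ-zeroʳ (ι x)
          ; *ₗ-distribˡ = λ x → *ₗ-distribˡ (ι x)
          }
        }
      ; -ᴹ‿cong = -ᴹ‿cong
      ; -ᴹ‿inverse = -ᴹ‿inverse
      }
    }
    where
      open LeftModule M
      open IsRingHomomorphism ι-homo

-- K is identified with a subfield of L along ι; a homomorphism of fields is
-- automatically injective.

module Over
  {q Q : ℕ} {cK ℓK₁ ℓK₂ cL ℓL₁ ℓL₂ : Level}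
  (K : FiniteField q cK ℓK₁ ℓK₂) (L : FiniteField Q cL ℓL₁ ℓL₂)
  (ι : FiniteField.Carrier K → FiniteField.Carrier L)
  (ι-homo : RingMorphisms.IsRingHomomorphism
              (FiniteField.rawRing K) (FiniteField.rawRing L) ι)
  where

  private
    module K = FiniteField K
    module L = FiniteField L

  overK : LeftModule L.ring a b → LeftModule K.ring a b
  overK = restrictScalars K.ring L.ring ι ι-homo

  L/K : LeftModule K.ring cL ℓL₁
  L/K = overK TensorUnit.leftModule

  1∷_ : ∀ {r} → Vector L.Carrier r → Vector L.Carrier (1 + r)
  1∷ u = L.1# ∷ u

  module _ (V : LeftModule L.ring a b) {m : ℕ}
           (Y : Vector (LeftModule.Carrierᴹ V) m) where

    T : ∀ {k r} → k ≤ m + 1 → r ≤ k ∸ 1 → Vector L.Carrier r →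
        Pred (LeftModule.Carrierᴹ V) (cK ⊔ b)
    T {k} {r} k≤m+1 r≤k∸1 u = Span (overK V) (Y₁⋯Yₖ₋₁ ++ (u·Y ∷ []))
      where
        k∸1≤m : k ∸ 1 ≤ m
        k∸1≤m = m≤n+o⇒m∸n≤o k 1 (≤-trans k≤m+1 (≤-reflexive (+-comm m 1)))

        Y₁⋯Yₖ₋₁ : Vector (LeftModule.Carrierᴹ V) (k ∸ 1)
        Y₁⋯Yₖ₋₁ i = Y (inject≤ i k∸1≤m)

        u·Y : LeftModule.Carrierᴹ V
        u·Y = linearCombination V u (λ i → Y₁⋯Yₖ₋₁ (inject≤ i r≤k∸1))

{-# OPTIONS --safe #-}
{-
Put n = k - 1, X = (Y₁, …, Yₙ) and pad u with zeros to ũ of length n.  Then T(u) is the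
GF(q)-span of the family F(u) = (Σ ũᵢXᵢ, -X₁, …, -Xₙ), and the GF(q^l)-linear relations
among F(u) are exactly the multiples of (1, ũ).

If g maps T(u) onto T(u′), write g F(u) and F(u′) in terms of each other with matrices
B, C over GF(q).  Since g preserves relations, (1, ũ) B = σ (1, ũ′) and
(1, ũ′) C = τ (1, ũ); since F(u′) is GF(q)-independent, C B = 1, so σ τ = 1.  As B and C
have entries in GF(q), τ ⟨1, u⟩ = ⟨1, u′⟩.

Conversely, s ⟨1, u⟩ = ⟨1, u′⟩ yields mutually inverse matrices P, P′ over GF(q) with
s⁻¹ (1, u′) = P (1, u) and s (1, u) = P′ (1, u′).  Write f(u) for F(u) restricted to the
indices 0, …, r.  The GF(q^l)-linear map that fixes Yⱼ for j > r and maps f(u) to Pᵗ f(u′)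
is well defined, because P carries the relation (1, u) to a multiple of the relation
(1, u′).  It maps T(u) into T(u′), and P′ gives its inverse.
-}
module Submission where

open import Defs
open import Algebra.Bundles using (Ring; CommutativeRing)
import Algebra.Apartness.Properties.HeytingCommutativeRing as HeytingProperties
open import Algebra.Module.Bundles using (LeftModule)
import Algebra.Module.Construct.TensorUnit as TensorUnit
open import Algebra.Module.Morphism.Construct.Composition
  using () renaming (isLeftModuleHomomorphism to isLeftModuleHomomorphism-∘)
open import Algebra.Module.Morphism.Construct.Identity
  using () renaming (isLeftModuleHomomorphism to isLeftModuleHomomorphism-id)
open import Algebra.Module.Morphism.Structures
  using (IsLeftModuleHomomorphism; IsLeftModuleIsomorphism)
import Algebra.Module.Properties.LeftModule as LeftModuleProperties
open import Algebra.Morphism.Structures using (module RingMorphisms)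
open import Algebra.Properties.CommutativeMonoid.Sum
  using (sum-cong-≋; sum-replicate-zero; ∑-distrib-+)
import Algebra.Properties.Ring as RingProperties
open import Data.Fin.Base using (Fin; zero; suc; _↑ˡ_; _↑ʳ_; splitAt; join; inject≤)
open import Data.Fin.Properties using (join-splitAt; toℕ-injective; toℕ-inject≤; toℕ-↑ˡ)
open import Data.Nat.Base as ℕ using (ℕ; zero; suc; _∸_; _^_; _≤_; _⊓_; s≤s)
open import Data.Nat.Properties
  using (m≤n⊓o⇒m≤n; m≤n+o⇒m∸n≤o; m≤n⇒∃[o]m+o≡n; ≤-trans; ≤-reflexive; +-comm)
open import Data.Product.Base using (∃-syntax; _×_; _,_; proj₁; proj₂)
open import Data.Sum.Base using (inj₁; inj₂)
open import Data.Vec.Functional using (Vector; _∷_; []; _++_)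
open import Data.Vec.Functional.Properties using (lookup-++ˡ; lookup-++ʳ)
open import Function.Base using (_∘_; const)
open import Function.Bundles using (_⇔_; mk⇔)
open import Level using (Level; _⊔_)
open import Relation.Binary.Bundles using (Setoid)
open import Relation.Binary.PropositionalEquality.Core as ≡ using (_≡_)
import Relation.Binary.Reasoning.Setoid as ≈-Reasoning
open import Relation.Unary using (Pred; _∈_; _⊆_; _≐_)
open import Relation.Unary.Properties using (≐-sym; ≐-trans)

private
  variable
    a b c ℓ a′ b′ p ℓ₁ ℓ₂ : Level
    m n : ℕ

-- Index sets split into two blocks

inject≤-↑ˡ : (i : Fin m) .(m≤m+n : m ≤ m ℕ.+ n) → inject≤ i m≤m+n ≡ i ↑ˡ n
inject≤-↑ˡ {n = n} i m≤m+n = toℕ-injective (≡.trans (toℕ-inject≤ i m≤m+n) (≡.sym (toℕ-↑ˡ i n)))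

Fin-+-elim : (P : Fin (m ℕ.+ n) → Set p) →
             (∀ i → P (i ↑ˡ n)) → (∀ j → P (m ↑ʳ j)) → ∀ i → P i
Fin-+-elim {m} {n} P l r i = ≡.subst P (join-splitAt m n i) (go (splitAt m i))
  where
  go : ∀ s → P (join m n s)
  go (inj₁ i) = l i
  go (inj₂ j) = r j

-- Coordinate vectors and products of row vectors with matrices

module Coefficients (R : Ring c ℓ) where
  open Ring R hiding (zero)

  unit : Fin n → Vector Carrier n
  unit zero    = 1# ∷ const 0#
  unit (suc i) = 0# ∷ unit i

  -- The maps built from a Singer cycle act by transposed matrices, so the identity matrix turns up
  -- transposed as well.
  unit-sym : (i j : Fin n) → unit i j ≡ unit j i
  unit-sym zero    zero    = ≡.refl
  unit-sym zero    (suc j) = ≡.refl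
  unit-sym (suc i) zero    = ≡.refl
  unit-sym (suc i) (suc j) = unit-sym i j

  infixl 7 _·_

  -- The row vector `x` times the matrix whose `j`-th row is `B j`.
  _·_ : Vector Carrier m → (Fin m → Vector Carrier n) → Vector Carrier n
  (x · B) i = linearCombination (TensorUnit.leftModule {R = R}) x (λ j → B j i)

-- Linear combinations and spans

module _ {R : Ring c ℓ} (M : LeftModule R a b) where
  open Coefficients R
  open Ring R hiding (zero)
  open LeftModule M
  open RingProperties R using (-1*x≈-x; x∙y⁻¹≈ε⇒x≈y)
  open ≈-Reasoning ≈ᴹ-setoid

  private
    lc : Vector Carrier n → Vector Carrierᴹ n → Carrierᴹ
    lc = linearCombination M

  lc-cong : {x y : Vector Carrier n} {v w : Vector Carrierᴹ n} →
            (∀ i → x i ≈ y i) → (∀ i → v i ≈ᴹ w i) → lc x v ≈ᴹ lc y w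
  lc-cong x≈y v≈w = sum-cong-≋ +ᴹ-commutativeMonoid (λ i → *ₗ-cong (x≈y i) (v≈w i))

  lc-congˡ : (x : Vector Carrier n) {v w : Vector Carrierᴹ n} →
             (∀ i → v i ≈ᴹ w i) → lc x v ≈ᴹ lc x w
  lc-congˡ x = lc-cong (λ _ → refl)

  lc-congʳ : {x y : Vector Carrier n} (v : Vector Carrierᴹ n) →
             (∀ i → x i ≈ y i) → lc x v ≈ᴹ lc y v
  lc-congʳ v x≈y = lc-cong x≈y (λ _ → ≈ᴹ-refl)

  lc-zero : (v : Vector Carrierᴹ n) → lc (const 0#) v ≈ᴹ 0ᴹ
  lc-zero {n} v = ≈ᴹ-trans (sum-cong-≋ +ᴹ-commutativeMonoid (λ i → *ₗ-zeroˡ (v i)))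
                           (sum-replicate-zero +ᴹ-commutativeMonoid n)

  lc-+ : (x y : Vector Carrier n) (v : Vector Carrierᴹ n) →
         lc (λ i → x i + y i) v ≈ᴹ lc x v +ᴹ lc y v
  lc-+ x y v = ≈ᴹ-trans
    (sum-cong-≋ +ᴹ-commutativeMonoid (λ i → *ₗ-distribʳ (v i) (x i) (y i)))
    (∑-distrib-+ +ᴹ-commutativeMonoid (λ i → x i *ₗ v i) (λ i → y i *ₗ v i))

  lc-*ₗ : ∀ s (x : Vector Carrier n) (v : Vector Carrierᴹ n) →
          s *ₗ lc x v ≈ᴹ lc (λ i → s * x i) v
  lc-*ₗ {zero}  s x v = *ₗ-zeroʳ s
  lc-*ₗ {suc n} s x v = ≈ᴹ-trans (*ₗ-distribˡ s _ _)
    (+ᴹ-cong (≈ᴹ-sym (*ₗ-assoc s _ _)) (lc-*ₗ s (x ∘ suc) (v ∘ suc)))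

  -- Turns the substitution of one family into another into a matrix product: x(Bv) = (xB)v.
  lc-· : (x : Vector Carrier m) (B : Fin m → Vector Carrier n) (v : Vector Carrierᴹ n) →
         lc x (λ j → lc (B j) v) ≈ᴹ lc (x · B) v
  lc-· {zero}  x B v = ≈ᴹ-sym (lc-zero v)
  lc-· {suc m} x B v = ≈ᴹ-trans
    (+ᴹ-cong (lc-*ₗ (x zero) (B zero) v) (lc-· (x ∘ suc) (B ∘ suc) v))
    (≈ᴹ-sym (lc-+ _ _ v))

  lc-unit : (i : Fin n) (v : Vector Carrierᴹ n) → lc (unit i) v ≈ᴹ v i
  lc-unit zero    v = ≈ᴹ-trans (+ᴹ-cong (*ₗ-identityˡ _) (lc-zero (v ∘ suc))) (+ᴹ-identityʳ _)
  lc-unit (suc i) v = ≈ᴹ-trans (+ᴹ-cong (*ₗ-zeroˡ _) (lc-unit i (v ∘ suc))) (+ᴹ-identityˡ _)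

  lc-split : ∀ m (x : Vector Carrier (m ℕ.+ n)) (v : Vector Carrierᴹ (m ℕ.+ n)) →
             lc x v ≈ᴹ lc (x ∘ (_↑ˡ n)) (v ∘ (_↑ˡ n)) +ᴹ lc (x ∘ (m ↑ʳ_)) (v ∘ (m ↑ʳ_))
  lc-split zero    x v = ≈ᴹ-sym (+ᴹ-identityˡ _)
  lc-split (suc m) x v = ≈ᴹ-trans (+ᴹ-cong ≈ᴹ-refl (lc-split m (x ∘ suc) (v ∘ suc)))
                                  (≈ᴹ-sym (+ᴹ-assoc _ _ _))

  lc-++-zero : (x : Vector Carrier m) (v : Vector Carrierᴹ (m ℕ.+ n)) →
               lc (x ++ const 0#) v ≈ᴹ lc x (v ∘ (_↑ˡ n))
  lc-++-zero {m} {n} x v = begin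
    lc (x ++ const 0#) v ≈⟨ lc-split m _ v ⟩
    lc ((x ++ const 0#) ∘ (_↑ˡ n)) (v ∘ (_↑ˡ n)) +ᴹ lc ((x ++ const 0#) ∘ (m ↑ʳ_)) (v ∘ (m ↑ʳ_))
      ≈⟨ +ᴹ-cong (lc-congʳ (v ∘ (_↑ˡ n)) (λ i → reflexive (lookup-++ˡ x (const 0#) i)))
                 (lc-congʳ (v ∘ (m ↑ʳ_)) (λ i → reflexive (lookup-++ʳ x (const 0#) i))) ⟩
    lc x (v ∘ (_↑ˡ n)) +ᴹ lc (const 0#) (v ∘ (m ↑ʳ_)) ≈⟨ +ᴹ-cong ≈ᴹ-refl (lc-zero (v ∘ (m ↑ʳ_))) ⟩
    lc x (v ∘ (_↑ˡ n)) +ᴹ 0ᴹ                          ≈⟨ +ᴹ-identityʳ _ ⟩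
    lc x (v ∘ (_↑ˡ n)) ∎

  unit∈Span : (v : Vector Carrierᴹ n) (i : Fin n) → v i ∈ Span M v
  unit∈Span v i = unit i , ≈ᴹ-sym (lc-unit i v)

  Span-resp-≈ : (v : Vector Carrierᴹ n) {x y : Carrierᴹ} → x ≈ᴹ y → x ∈ Span M v → y ∈ Span M v
  Span-resp-≈ v x≈y (k , x≈) = k , ≈ᴹ-trans (≈ᴹ-sym x≈y) x≈

  Span-*ₗ : (v : Vector Carrierᴹ n) {x : Carrierᴹ} → ∀ s → x ∈ Span M v → s *ₗ x ∈ Span M v
  Span-*ₗ v s (k , x≈) = (λ i → s * k i) , ≈ᴹ-trans (*ₗ-cong refl x≈) (lc-*ₗ s k v)

  independent⇒unique : {v : Vector Carrierᴹ n} → LinearlyIndependent M v →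
                       ∀ {x y} → lc x v ≈ᴹ lc y v → ∀ i → x i ≈ y i
  independent⇒unique {v = v} indep {x} {y} eq i = x∙y⁻¹≈ε⇒x≈y (x i) (y i) (indep _ (begin
    lc (λ j → x j - y j) v             ≈⟨ lc-+ x (λ j → - y j) v ⟩
    lc x v +ᴹ lc (λ j → - y j) v       ≈⟨ +ᴹ-cong eq (lc-congʳ v (λ j → sym (-1*x≈-x (y j)))) ⟩
    lc y v +ᴹ lc (λ j → - 1# * y j) v  ≈⟨ +ᴹ-cong (*ₗ-identityˡ _) (lc-*ₗ (- 1#) y v) ⟨
    1# *ₗ lc y v +ᴹ - 1# *ₗ lc y v     ≈⟨ *ₗ-distribʳ _ 1# (- 1#) ⟨
    (1# + - 1#) *ₗ lc y v              ≈⟨ *ₗ-congʳ (-‿inverseʳ 1#) ⟩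
    0# *ₗ lc y v                       ≈⟨ *ₗ-zeroˡ _ ⟩
    0ᴹ                                 ∎) i)

  -- A relation on the first block, padded with zeros, is a relation on the whole family.
  independent-↑ˡ : {v : Vector Carrierᴹ (m ℕ.+ n)} → LinearlyIndependent M v →
                   LinearlyIndependent M (v ∘ (_↑ˡ n))
  independent-↑ˡ {n = n} {v = v} indep x eq i = trans
    (reflexive (≡.sym (lookup-++ˡ x (const 0#) i)))
    (indep (x ++ const 0#) (≈ᴹ-trans (lc-++-zero x v) eq) (i ↑ˡ n))

-- Module homomorphisms

module _ {R : Ring c ℓ} (M : LeftModule R a b) (N : LeftModule R a′ b′) where
  open Coefficients R
  open Ring R using (Carrier; 0#)
  private
    module M = LeftModule M
    module N = LeftModule N
  open ≈-Reasoning N.≈ᴹ-setoid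

  Homomorphism : (M.Carrierᴹ → N.Carrierᴹ) → Set _
  Homomorphism = IsLeftModuleHomomorphism M.rawLeftModule N.rawLeftModule

  -- Zero is preserved because f(0) = f(0 · 0) = 0 · f(0), and negatives because additive inverses
  -- are unique, so these three properties suffice.
  mkHomomorphism : {f : M.Carrierᴹ → N.Carrierᴹ} →
                   (∀ {x y} → x M.≈ᴹ y → f x N.≈ᴹ f y) →
                   (∀ x y → f (x M.+ᴹ y) N.≈ᴹ f x N.+ᴹ f y) →
                   (∀ s x → f (s M.*ₗ x) N.≈ᴹ s N.*ₗ f x) → Homomorphism f
  mkHomomorphism {f} cong + * = record
    { +ᴹ-isGroupHomomorphism = record
      { isMonoidHomomorphism = record
        { isMagmaHomomorphism = record
          { isRelHomomorphism = record { cong = cong } ; homo = + }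
        ; ε-homo = f0≈0
        }
      ; ⁻¹-homo = λ x → inverseˡ-uniqueᴹ (f (M.-ᴹ x)) (f x) (begin
          f (M.-ᴹ x) N.+ᴹ f x ≈⟨ + _ _ ⟨
          f (M.-ᴹ x M.+ᴹ x)   ≈⟨ cong (M.-ᴹ‿inverseˡ x) ⟩
          f M.0ᴹ              ≈⟨ f0≈0 ⟩
          N.0ᴹ                ∎)
      }
    ; *ₗ-homo = *
    }
    where
    open LeftModuleProperties N using (inverseˡ-uniqueᴹ)
    f0≈0 : f M.0ᴹ N.≈ᴹ N.0ᴹ
    f0≈0 = begin
      f M.0ᴹ           ≈⟨ cong (M.*ₗ-zeroʳ 0#) ⟨
      f (0# M.*ₗ M.0ᴹ) ≈⟨ * 0# M.0ᴹ ⟩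
      0# N.*ₗ f M.0ᴹ   ≈⟨ N.*ₗ-zeroˡ _ ⟩
      N.0ᴹ             ∎

  module _ {f : M.Carrierᴹ → N.Carrierᴹ} (hom : Homomorphism f) where
    open IsLeftModuleHomomorphism hom

    lc-homo : (x : Vector Carrier n) (v : Vector M.Carrierᴹ n) →
              f (linearCombination M x v) N.≈ᴹ linearCombination N x (f ∘ v)
    lc-homo {zero}  x v = 0ᴹ-homo
    lc-homo {suc n} x v = N.≈ᴹ-trans (+ᴹ-homo _ _)
      (N.+ᴹ-cong (*ₗ-homo _ _) (lc-homo (x ∘ suc) (v ∘ suc)))

    Span-homo : (v : Vector M.Carrierᴹ m) (w : Vector N.Carrierᴹ n) →
                (∀ i → f (v i) ∈ Span N w) → ∀ {x} → x ∈ Span M v → f x ∈ Span N w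
    Span-homo v w fv∈ {x} (k , x≈) = k · (proj₁ ∘ fv∈) , (begin
      f x                                                     ≈⟨ ⟦⟧-cong x≈ ⟩
      f (linearCombination M k v)                             ≈⟨ lc-homo k v ⟩
      linearCombination N k (f ∘ v)                           ≈⟨ lc-congˡ N k (proj₂ ∘ fv∈) ⟩
      linearCombination N k (λ i → linearCombination N (proj₁ (fv∈ i)) w)
                                                              ≈⟨ lc-· N k (proj₁ ∘ fv∈) w ⟩
      linearCombination N (k · (proj₁ ∘ fv∈)) w ∎)

-- Inclusions of spans, and linear maps prescribed on a basis

module _ {R : Ring c ℓ} (M : LeftModule R a b) where
  open Coefficients R
  open Ring R using (Carrier; _*_)
  open LeftModule M
  open ≈-Reasoning ≈ᴹ-setoid

  Span-⊆ : (v : Vector Carrierᴹ m) (w : Vector Carrierᴹ n) →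
           (∀ i → v i ∈ Span M w) → Span M v ⊆ Span M w
  Span-⊆ = Span-homo M M (isLeftModuleHomomorphism-id rawLeftModule ≈ᴹ-refl)

  module _ {Y : Vector Carrierᴹ n} (basis : IsBasis M Y) where

    private
      coords : Carrierᴹ → Vector Carrier n
      coords v = proj₁ (proj₂ basis v)

      coords-≈ : ∀ v → v ≈ᴹ linearCombination M (coords v) Y
      coords-≈ v = proj₂ (proj₂ basis v)

    agree-on-basis : ∀ {f g} → Homomorphism M M f → Homomorphism M M g →
                     (∀ i → f (Y i) ≈ᴹ g (Y i)) → ∀ v → f v ≈ᴹ g v
    agree-on-basis {f} {g} F G fY≈gY v = begin
      f v                                     ≈⟨ IsLeftModuleHomomorphism.⟦⟧-cong F (coords-≈ v) ⟩
      f (linearCombination M (coords v) Y)    ≈⟨ lc-homo M M F (coords v) Y ⟩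
      linearCombination M (coords v) (f ∘ Y)  ≈⟨ lc-congˡ M (coords v) fY≈gY ⟩
      linearCombination M (coords v) (g ∘ Y)  ≈⟨ lc-homo M M G (coords v) Y ⟨
      g (linearCombination M (coords v) Y)    ≈⟨ IsLeftModuleHomomorphism.⟦⟧-cong G (coords-≈ v) ⟨
      g v                                     ∎

    extend-linearly : (Z : Vector Carrierᴹ n) →
                      ∃[ g ] (Homomorphism M M g × (∀ i → g (Y i) ≈ᴹ Z i))
    extend-linearly Z = g , mkHomomorphism M M
      (λ {v} {w} v≈w → determined {v} (coords w) (≈ᴹ-trans v≈w (coords-≈ w)))
      (λ v w → ≈ᴹ-trans
        (determined _ (≈ᴹ-trans (+ᴹ-cong (coords-≈ v) (coords-≈ w)) (≈ᴹ-sym (lc-+ M _ _ Y))))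
        (lc-+ M _ _ Z))
      (λ s v → ≈ᴹ-trans
        (determined _ (≈ᴹ-trans (*ₗ-congˡ (coords-≈ v)) (lc-*ₗ M s _ Y)))
        (≈ᴹ-sym (lc-*ₗ M s _ Z)))
      , λ i → ≈ᴹ-trans (determined (unit i) (≈ᴹ-sym (lc-unit M i Y))) (lc-unit M i Z)
      where
      g : Carrierᴹ → Carrierᴹ
      g v = linearCombination M (coords v) Z

      -- Coordinates are unique by independence, so `g v` can be computed from any expression of `v`
      -- in the basis. Congruence, additivity, homogeneity and the values on the basis are all
      -- instances of this.
      determined : ∀ {v} x → v ≈ᴹ linearCombination M x Y → g v ≈ᴹ linearCombination M x Z
      determined {v} x v≈ = lc-congʳ M Z
        (independent⇒unique M (proj₁ basis) (≈ᴹ-trans (≈ᴹ-sym (coords-≈ v)) v≈))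

    -- Both composites agree with the identity on a basis, hence everywhere; one gives injectivity,
    -- the other surjectivity. The second composite is also returned, since it supplies preimages
    -- under `g`.
    inverse-on-basis⇒GL : ∀ {g h} → Homomorphism M M g → Homomorphism M M h →
                          (∀ i → h (g (Y i)) ≈ᴹ Y i) → (∀ i → g (h (Y i)) ≈ᴹ Y i) →
                          g ∈ GL M × (∀ v → g (h v) ≈ᴹ v)
    inverse-on-basis⇒GL {g} {h} G H hgY≈Y ghY≈Y = record
      { isLeftModuleMonomorphism = record
        { isLeftModuleHomomorphism = G
        ; injective = λ {v} {w} gv≈gw → ≈ᴹ-trans (≈ᴹ-sym (inverse G H hgY≈Y v))
            (≈ᴹ-trans (H.⟦⟧-cong gv≈gw) (inverse G H hgY≈Y w))
        }
      ; surjective = λ v → h v , λ z≈hv → ≈ᴹ-trans (G.⟦⟧-cong z≈hv) (inverse H G ghY≈Y v)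
      } , inverse H G ghY≈Y
      where
      module G = IsLeftModuleHomomorphism G
      module H = IsLeftModuleHomomorphism H
      inverse : ∀ {f g} → Homomorphism M M f → Homomorphism M M g →
                (∀ i → g (f (Y i)) ≈ᴹ Y i) → ∀ v → g (f v) ≈ᴹ v
      inverse F G = agree-on-basis
        (isLeftModuleHomomorphism-∘ {M₁ = rawLeftModule} {M₂ = rawLeftModule} {M₃ = rawLeftModule}
          ≈ᴹ-trans F G)
        (isLeftModuleHomomorphism-id rawLeftModule ≈ᴹ-refl)

-- Orbits up to extensional equality of subsets

module _ (S : Setoid a b) where
  open Setoid S using (Carrier)

  Orbit-resp-≐ : {G : Pred (Carrier → Carrier) ℓ} {W W₁ : Pred Carrier ℓ₁} {W′ W′₁ : Pred Carrier ℓ₂} →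
                 W ≐ W₁ → W′ ≐ W′₁ → W′ ∈ Orbit S G W → W′₁ ∈ Orbit S G W₁
  Orbit-resp-≐ (W⊆W₁ , W₁⊆W) (W′⊆W′₁ , W′₁⊆W′) (g , g∈G , gW⊆W′ , W′⊆gW) =
    g , g∈G
      , (λ (x , x∈W₁ , y≈gx) → W′⊆W′₁ (gW⊆W′ (x , W₁⊆W x∈W₁ , y≈gx)))
      , λ y∈W′₁ → let x , x∈W , y≈gx = W′⊆gW (W′₁⊆W′ y∈W′₁) in x , W⊆W₁ x∈W , y≈gx

-- The family `graph` and its linear relations

module _ (R : CommutativeRing c ℓ) (M : LeftModule (CommutativeRing.ring R) a b) where
  open CommutativeRing R hiding (zero)
  open RingProperties ring using (-1*x≈-x; x∙y⁻¹≈ε⇒x≈y; -‿involutive)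
  open LeftModule M
  open LeftModuleProperties M using (inverseˡ-uniqueᴹ)

  -- Both sides are the additive inverse of `w`.
  inverse⇒-1*ₗ : ∀ {v w} → v +ᴹ w ≈ᴹ 0ᴹ → - 1# *ₗ w ≈ᴹ v
  inverse⇒-1*ₗ {v} {w} v+w≈0 = ≈ᴹ-trans (inverseˡ-uniqueᴹ _ w -w+w≈0) (≈ᴹ-sym (inverseˡ-uniqueᴹ v w v+w≈0))
    where
    -w+w≈0 : - 1# *ₗ w +ᴹ w ≈ᴹ 0ᴹ
    -w+w≈0 = ≈ᴹ-trans (+ᴹ-congˡ (≈ᴹ-sym (*ₗ-identityˡ w))) (≈ᴹ-trans (≈ᴹ-sym (*ₗ-distribʳ w _ _))
      (≈ᴹ-trans (*ₗ-congʳ (-‿inverseˡ 1#)) (*ₗ-zeroˡ w)))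

  negate-twice : ∀ v → - 1# *ₗ - 1# *ₗ v ≈ᴹ v
  negate-twice v = ≈ᴹ-trans (≈ᴹ-sym (*ₗ-assoc _ _ v))
    (≈ᴹ-trans (*ₗ-congʳ (trans (-1*x≈-x _) (-‿involutive 1#))) (*ₗ-identityˡ v))

  -- The signs are chosen so that `1# ∷ x` itself is a relation of this family.
  graph : Vector Carrier n → Vector Carrierᴹ n → Vector Carrierᴹ (suc n)
  graph x X = linearCombination M x X ∷ λ i → - 1# *ₗ X i

  lc-scale : ∀ s (x : Vector Carrier n) (v : Vector Carrierᴹ n) →
             linearCombination M x (λ i → s *ₗ v i) ≈ᴹ s *ₗ linearCombination M x v
  lc-scale s x v = ≈ᴹ-trans
    (sum-cong-≋ +ᴹ-commutativeMonoid λ i →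
      ≈ᴹ-trans (≈ᴹ-sym (*ₗ-assoc (x i) s (v i))) (*ₗ-congʳ (*-comm (x i) s)))
    (≈ᴹ-sym (lc-*ₗ M s x v))

  lc-graph : ∀ y (x : Vector Carrier n) X → linearCombination M y (graph x X) ≈ᴹ
             linearCombination M (λ i → y zero * x i - y (suc i)) X
  lc-graph y x X = ≈ᴹ-trans
    (+ᴹ-cong (lc-*ₗ M (y zero) x X)
      (≈ᴹ-trans (lc-scale (- 1#) (y ∘ suc) X) (≈ᴹ-trans (lc-*ₗ M (- 1#) (y ∘ suc) X)
        (lc-congʳ M X (λ i → -1*x≈-x (y (suc i)))))))
    (≈ᴹ-sym (lc-+ M _ _ X))

  graph-relation : (x : Vector Carrier n) (X : Vector Carrierᴹ n) →
                   linearCombination M (1# ∷ x) (graph x X) ≈ᴹ 0ᴹ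
  graph-relation x X = ≈ᴹ-trans (lc-graph (1# ∷ x) x X)
    (≈ᴹ-trans (lc-congʳ M X (λ i → trans (+-congʳ (*-identityˡ _)) (-‿inverseʳ _))) (lc-zero M X))

  -- By `lc-graph` the relation `y` has the coefficient `y zero * x i - y (suc i)` at `X i`, which
  -- vanishes by independence. So the relations form the line through `1# ∷ x`.
  graph-relation-unique : (X : Vector Carrierᴹ n) → LinearlyIndependent M X →
    ∀ x y → linearCombination M y (graph x X) ≈ᴹ 0ᴹ → ∀ i → y i ≈ y zero * (1# ∷ x) i
  graph-relation-unique X indep x y eq zero = sym (*-identityʳ _)
  graph-relation-unique X indep x y eq (suc i) =
    sym (x∙y⁻¹≈ε⇒x≈y _ _ (indep _ (≈ᴹ-trans (≈ᴹ-sym (lc-graph y x X)) eq) i))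

-- The field extension and multiplication by its elements

module _
  {q Q : ℕ} {cK ℓK₁ ℓK₂ cL ℓL₁ ℓL₂ : Level}
  (K : FiniteField q cK ℓK₁ ℓK₂) (L : FiniteField Q cL ℓL₁ ℓL₂)
  (ι : FiniteField.Carrier K → FiniteField.Carrier L)
  (ι-homo : RingMorphisms.IsRingHomomorphism
              (FiniteField.rawRing K) (FiniteField.rawRing L) ι)
  where

  private
    module K where
      open FiniteField K using (commutativeRing; ring) public
      open CommutativeRing commutativeRing hiding (ring; zero) public
      open Coefficients ring public
      unitModule : LeftModule ring _ _
      unitModule = TensorUnit.leftModule
    module L where
      open FiniteField L using (commutativeRing; ring; _#_; #⇒invertible; heytingCommutativeRing) public
      open CommutativeRing commutativeRing hiding (ring; zero) public
      open HeytingProperties heytingCommutativeRing using (x-0≈x; invertibleˡ⇒#) public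
      open Coefficients ring public
      unitModule : LeftModule ring _ _
      unitModule = TensorUnit.leftModule
    module ι = RingMorphisms.IsRingHomomorphism ι-homo
  open Over K L ι ι-homo

  -- Apartness from zero amounts to invertibility of `t - 0#`, hence of `t`.
  inverse⇒#0 : ∀ {s t} → s L.* t L.≈ L.1# → t L.# L.0#
  inverse⇒#0 {s} {t} st≈1 = L.invertibleˡ⇒# (s , L.trans (L.*-congˡ (L.x-0≈x t)) st≈1)

  #0⇒inverse : ∀ {t} → t L.# L.0# → ∃[ s ] s L.* t L.≈ L.1#
  #0⇒inverse {t} t#0 = let s , st≈1 , _ = L.#⇒invertible t#0 in
    s , L.trans (L.*-congˡ (L.sym (L.x-0≈x t))) st≈1

  -- Viewing `ι` as a K-linear map lets `lc-homo` carry products of matrices over K into L.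
  ι-homomorphism : Homomorphism K.unitModule L/K ι
  ι-homomorphism = mkHomomorphism K.unitModule L/K ι.⟦⟧-cong ι.+-homo ι.*-homo

  -- By commutativity, the entries of a row over L times a matrix over K are K-combinations of the
  -- entries of the row.
  lc-comm : (y : Vector L.Carrier n) (k : Vector K.Carrier n) →
            linearCombination L.unitModule y (ι ∘ k) L.≈ linearCombination L/K k y
  lc-comm y k = sum-cong-≋ L.+-commutativeMonoid (λ j → L.*-comm (y j) (ι (k j)))

  scaling-homomorphism : ∀ s → Homomorphism L/K L/K (s L.*_)
  scaling-homomorphism s = mkHomomorphism L/K L/K L.*-congˡ (L.distribˡ s)
    (λ k x → L.trans (L.sym (L.*-assoc s (ι k) x))
      (L.trans (L.*-congʳ (L.*-comm s (ι k))) (L.*-assoc (ι k) s x)))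

  -- Multiplication by `t` maps the span of `v` into that of `v′`, and it is onto because y = t(sy).
  scaling-orbit : ∀ (v : Vector L.Carrier m) (v′ : Vector L.Carrier n) {s t} → s L.* t L.≈ L.1# →
                  (∀ i → s L.* v′ i ∈ Span L/K v) → (∀ i → t L.* v i ∈ Span L/K v′) →
                  Span L/K v′ ∈ Orbit L.setoid (SingerCycle L) (Span L/K v)
  scaling-orbit v v′ {s} {t} st≈1 sv′∈ tv∈ =
    t L.*_ , (t , inverse⇒#0 st≈1 , λ _ → L.refl)
    , (λ (x , x∈ , y≈tx) → Span-resp-≈ L/K v′ (L.sym y≈tx)
        (Span-homo L/K L/K (scaling-homomorphism t) v v′ tv∈ x∈))
    , λ {y} y∈ → s L.* y , Span-homo L/K L/K (scaling-homomorphism s) v′ v sv′∈ y∈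
        , (begin
          y               ≈⟨ L.*-identityˡ y ⟨
          L.1# L.* y      ≈⟨ L.*-congʳ st≈1 ⟨
          s L.* t L.* y   ≈⟨ L.*-congʳ (L.*-comm s t) ⟩
          t L.* s L.* y   ≈⟨ L.*-assoc t s y ⟩
          t L.* (s L.* y) ∎)
    where open ≈-Reasoning L.setoid

  module _ (V : LeftModule L.ring a b) where
    open LeftModule V

    private
      VK : LeftModule K.ring a b
      VK = overK V

    -- From the GL-orbit to the Singer orbit

    module _ {X : Vector Carrierᴹ n} (indep : LinearlyIndependent V X) (x x′ : Vector L.Carrier n)
             (graph-indep : LinearlyIndependent VK (graph L.commutativeRing V x′ X)) where
      private
        F F′ : Vector Carrierᴹ (suc n)
        F  = graph L.commutativeRing V x X
        F′ = graph L.commutativeRing V x′ X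

      GL-orbit⇒Singer-orbit :
        Span VK F′ ∈ Orbit ≈ᴹ-setoid (GL V) (Span VK F) →
        Span L/K (1∷ x′) ∈ Orbit L.setoid (SingerCycle L) (Span L/K (1∷ x))
      GL-orbit⇒Singer-orbit (g , g∈GL , gF⊆F′ , F′⊆gF) = scaling-orbit (1∷ x) (1∷ x′) στ≈1
        -- The scalars are `σ zero` and `τ zero`. Column `i` of `B` gives the coefficients over K of
        -- `σ zero * (1∷ x′) i` in terms of `1∷ x`; likewise for `C`.
        (λ i → (λ j → B j i) , L.trans (L.sym (σ-≈ i)) (lc-comm (1∷ x) (λ j → B j i)))
        (λ i → (λ j → C j i) , L.trans (L.sym (τ-≈ i)) (lc-comm (1∷ x′) (λ j → C j i)))
        where
        module g = IsLeftModuleIsomorphism g∈GL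
        open ≈-Reasoning ≈ᴹ-setoid

        B C : Fin (suc n) → Vector K.Carrier (suc n)
        B j = proj₁ (gF⊆F′ (F j , unit∈Span VK F j , ≈ᴹ-refl))
        C j = proj₁ (proj₁ (proj₂ (F′⊆gF (unit∈Span VK F′ j))))

        gF≈BF′ : ∀ j → g (F j) ≈ᴹ linearCombination VK (B j) F′
        gF≈BF′ j = proj₂ (gF⊆F′ (F j , unit∈Span VK F j , ≈ᴹ-refl))

        F′≈CgF : ∀ j → F′ j ≈ᴹ linearCombination VK (C j) (g ∘ F)
        F′≈CgF j with F′⊆gF (unit∈Span VK F′ j)
        ... | y , (c , y≈cF) , F′≈gy = ≈ᴹ-trans F′≈gy (≈ᴹ-trans (g.⟦⟧-cong y≈cF)
          (lc-homo V V g.isLeftModuleHomomorphism (ι ∘ c) F))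

        σ τ : Vector L.Carrier (suc n)
        σ = (1∷ x)  L.· (λ j i → ι (B j i))
        τ = (1∷ x′) L.· (λ j i → ι (C j i))

        -- `g` carries the relation `1∷ x` of `F` to the relation `σ` of `F′`.
        σ-≈ : ∀ i → σ i L.≈ σ zero L.* (1∷ x′) i
        σ-≈ = graph-relation-unique L.commutativeRing V X indep x′ σ (begin
          linearCombination V σ F′
            ≈⟨ lc-· V (1∷ x) (λ j i → ι (B j i)) F′ ⟨
          linearCombination V (1∷ x) (λ j → linearCombination VK (B j) F′)
            ≈⟨ lc-congˡ V (1∷ x) gF≈BF′ ⟨
          linearCombination V (1∷ x) (g ∘ F)
            ≈⟨ lc-homo V V g.isLeftModuleHomomorphism (1∷ x) F ⟨
          g (linearCombination V (1∷ x) F)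
            ≈⟨ g.⟦⟧-cong (graph-relation L.commutativeRing V x X) ⟩
          g 0ᴹ
            ≈⟨ g.0ᴹ-homo ⟩
          0ᴹ ∎)

        -- Substituting for `F′` turns its relation `1∷ x′` into the relation `τ` of `g ∘ F`;
        -- injectivity of `g` makes this a relation of `F`.
        τ-≈ : ∀ i → τ i L.≈ τ zero L.* (1∷ x) i
        τ-≈ = graph-relation-unique L.commutativeRing V X indep x τ (g.injective (begin
          g (linearCombination V τ F)
            ≈⟨ lc-homo V V g.isLeftModuleHomomorphism τ F ⟩
          linearCombination V τ (g ∘ F)
            ≈⟨ lc-· V (1∷ x′) (λ j i → ι (C j i)) (g ∘ F) ⟨
          linearCombination V (1∷ x′) (λ j → linearCombination VK (C j) (g ∘ F))
            ≈⟨ lc-congˡ V (1∷ x′) F′≈CgF ⟨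
          linearCombination V (1∷ x′) F′
            ≈⟨ graph-relation L.commutativeRing V x′ X ⟩
          0ᴹ
            ≈⟨ g.0ᴹ-homo ⟨
          g 0ᴹ ∎))

        -- `F′` is dependent over L but independent over K, so the coefficients over K in F′ =
        -- (CB)F′ can be compared.
        CB≈unit : ∀ j i → (C j K.· B) i K.≈ K.unit j i
        CB≈unit j = independent⇒unique VK {v = F′} graph-indep (begin
          linearCombination VK (C j K.· B) F′
            ≈⟨ lc-· VK (C j) B F′ ⟨
          linearCombination VK (C j) (λ i → linearCombination VK (B i) F′)
            ≈⟨ lc-congˡ VK (C j) gF≈BF′ ⟨
          linearCombination VK (C j) (g ∘ F)
            ≈⟨ F′≈CgF j ⟨
          F′ j
            ≈⟨ lc-unit VK j F′ ⟨
          linearCombination VK (K.unit j) F′ ∎)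

        -- With τ₀(1, x) = τ = (1, x′)C, the product τ₀σ₀ is the first entry of (1, x′)CB = (1, x′).
        στ≈1 : σ zero L.* τ zero L.≈ L.1#
        στ≈1 = R.begin
          σ zero L.* τ zero R.≈⟨ L.*-comm (σ zero) (τ zero) ⟩
          τ zero L.* σ zero
            R.≈⟨ lc-*ₗ L.unitModule (τ zero) (1∷ x) (λ i → ι (B i zero)) ⟩
          linearCombination L.unitModule (λ i → τ zero L.* (1∷ x) i) (λ i → ι (B i zero))
            R.≈⟨ lc-congʳ L.unitModule (λ i → ι (B i zero)) τ-≈ ⟨
          linearCombination L.unitModule τ (λ i → ι (B i zero))
            R.≈⟨ lc-· L.unitModule (1∷ x′) (λ j i → ι (C j i)) (λ i → ι (B i zero)) ⟨
          linearCombination L.unitModule (1∷ x′)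
            (λ j → linearCombination L/K (C j) (λ i → ι (B i zero)))
            R.≈⟨ lc-congˡ L.unitModule (1∷ x′) (λ j →
                   lc-homo K.unitModule L/K ι-homomorphism (C j) (λ i → B i zero)) ⟨
          linearCombination L.unitModule (1∷ x′) (λ j → ι ((C j K.· B) zero))
            R.≈⟨ lc-congˡ L.unitModule (1∷ x′) (λ j → ι.⟦⟧-cong (CB≈unit j zero)) ⟩
          linearCombination L.unitModule (1∷ x′) (λ j → ι (K.unit j zero))
            R.≈⟨ lc-congˡ L.unitModule (1∷ x′) {v = λ j → ι (K.unit j zero)} {w = L.unit zero}
                   (λ { zero → ι.1#-homo ; (suc j) → ι.0#-homo }) ⟩
          linearCombination L.unitModule (1∷ x′) (L.unit zero)
            R.≈⟨ L.+-cong (L.*-identityˡ _) (lc-0 x′) ⟩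
          L.1# L.+ L.0# R.≈⟨ L.+-identityʳ _ ⟩
          L.1# R.∎
          where
          module R = ≈-Reasoning L.setoid
          lc-0 : ∀ {k} (y : Vector L.Carrier k) →
                 linearCombination L.unitModule y (const L.0#) L.≈ L.0#
          lc-0 y = L.trans
            (sum-cong-≋ L.+-commutativeMonoid {y = λ i → L.0# L.* y i} (λ i → L.*-comm (y i) L.0#))
            (lc-zero L.unitModule y)

    -- The family `graph` over K: independence and comparison with the generators of `T`

    module _ {r d : ℕ} (X : Vector Carrierᴹ (suc r ℕ.+ d)) (indep : LinearlyIndependent V X)
             (u : Vector L.Carrier (suc r)) (u-indep : LinearlyIndependent L/K (1∷ u)) where
      open ≈-Reasoning L.setoid

      private
        -- A relation between 1 and the first coordinate of `u` is padded with zeros. This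
        -- coordinate exists because `u` has length `suc r`.
        1,u₀-independent : ∀ s t → ι s L.+ ι t L.* u zero L.≈ L.0# → s K.≈ K.0# × t K.≈ K.0#
        1,u₀-independent s t eq = u-indep x x≈0 zero , u-indep x x≈0 (suc zero)
          where
          x : Vector K.Carrier (suc (suc r))
          x = s ∷ t ∷ const K.0#
          x≈0 : linearCombination L/K x (1∷ u) L.≈ L.0#
          x≈0 = begin
            ι s L.* L.1# L.+ (ι t L.* u zero L.+ linearCombination L/K (const K.0#) (u ∘ suc))
              ≈⟨ L.+-cong (L.*-identityʳ _) (L.+-congˡ (lc-zero L/K (u ∘ suc))) ⟩
            ι s L.+ (ι t L.* u zero L.+ L.0#)
              ≈⟨ L.+-congˡ (L.+-identityʳ _) ⟩
            ι s L.+ ι t L.* u zero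
              ≈⟨ eq ⟩
            L.0# ∎

        ι-reflects-0 : ∀ s → ι s L.≈ L.0# → s K.≈ K.0#
        ι-reflects-0 s ιs≈0 = proj₁ (1,u₀-independent s K.0# (begin
          ι s L.+ ι K.0# L.* u zero ≈⟨ L.+-cong ιs≈0 (L.*-congʳ ι.0#-homo) ⟩
          L.0# L.+ L.0# L.* u zero  ≈⟨ L.trans (L.+-identityˡ _) (L.zeroˡ _) ⟩
          L.0# ∎))

      -- A relation `x` over K is `x zero` times (1, ũ). Comparing the next entry gives x₀u₀ = x₁, a
      -- K-relation between 1 and u₀; hence x₀ = 0, and with it every entry vanishes.
      graph-K-independent : LinearlyIndependent VK (graph L.commutativeRing V (u ++ const L.0#) X)
      graph-K-independent x eq = λ i → ι-reflects-0 (x i) (begin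
        ι (x i)                                    ≈⟨ ιx≈ i ⟩
        ι (x zero) L.* (1∷ (u ++ const L.0#)) i     ≈⟨ L.*-congʳ (ι.⟦⟧-cong x₀≈0) ⟩
        ι K.0# L.* (1∷ (u ++ const L.0#)) i         ≈⟨ L.*-congʳ ι.0#-homo ⟩
        L.0# L.* (1∷ (u ++ const L.0#)) i           ≈⟨ L.zeroˡ _ ⟩
        L.0#                                       ∎)
        where
        ιx≈ : ∀ i → ι (x i) L.≈ ι (x zero) L.* (1∷ (u ++ const L.0#)) i
        ιx≈ = graph-relation-unique L.commutativeRing V X indep (u ++ const L.0#) (ι ∘ x) eq
        x₀≈0 : x zero K.≈ K.0#
        x₀≈0 = proj₂ (1,u₀-independent (K.- x (suc zero)) (x zero) (begin
          ι (K.- x (suc zero)) L.+ ι (x zero) L.* u zero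
            ≈⟨ L.+-cong (ι.-‿homo _) (L.sym (ιx≈ (suc zero))) ⟩
          L.- ι (x (suc zero)) L.+ ι (x (suc zero))
            ≈⟨ L.-‿inverseˡ _ ⟩
          L.0# ∎))

    -- The generators differ by the scalar -1, which lies in K, and by the padding of `u` with
    -- zeros.
    Span-graph : ∀ {r d} (X : Vector Carrierᴹ (r ℕ.+ d)) (u : Vector L.Carrier r) →
                 Span VK (X ++ (linearCombination V u (X ∘ (_↑ˡ d)) ∷ [])) ≐
                 Span VK (graph L.commutativeRing V (u ++ const L.0#) X)
    Span-graph {r} {d} X u =
      Span-⊆ VK gens F (Fin-+-elim (λ i → gens i ∈ Span VK F)
        (λ i → ≡.subst (_∈ Span VK F) (≡.sym (lookup-++ˡ X _ i)) (X∈F i))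
        (λ { zero → ≡.subst (_∈ Span VK F) (≡.sym (lookup-++ʳ X _ zero))
               (Span-resp-≈ VK F (lc-++-zero V u X) (unit∈Span VK F zero)) }))
      , Span-⊆ VK F gens (λ
        { zero → Span-resp-≈ VK gens (≈ᴹ-sym (lc-++-zero V u X))
            (≡.subst (_∈ Span VK gens) (lookup-++ʳ X _ zero) (unit∈Span VK gens ((r ℕ.+ d) ↑ʳ zero)))
        ; (suc i) → Span-resp-≈ VK gens (*ₗ-congʳ -1-homo) (Span-*ₗ VK gens (K.- K.1#)
            (≡.subst (_∈ Span VK gens) (lookup-++ˡ X _ i) (unit∈Span VK gens (i ↑ˡ 1)))) })
      where
      gens : Vector Carrierᴹ (r ℕ.+ d ℕ.+ 1)
      gens = X ++ (linearCombination V u (X ∘ (_↑ˡ d)) ∷ [])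
      F : Vector Carrierᴹ (suc (r ℕ.+ d))
      F = graph L.commutativeRing V (u ++ const L.0#) X
      -1-homo : ι (K.- K.1#) L.≈ L.- L.1#
      -1-homo = L.trans (ι.-‿homo K.1#) (L.-‿cong ι.1#-homo)
      X∈F : ∀ i → X i ∈ Span VK F
      X∈F i = Span-resp-≈ VK F
        (≈ᴹ-trans (*ₗ-congʳ -1-homo) (negate-twice L.commutativeRing V (X i)))
        (Span-*ₗ VK F (K.- K.1#) (unit∈Span VK F (suc i)))

    -- From the Singer orbit to the GL-orbit, with the basis in blocks of lengths r, d, e

    module _ {r d e : ℕ} {Y : Vector Carrierᴹ (r ℕ.+ d ℕ.+ e)} (basis : IsBasis V Y) where
      private
        X : Vector Carrierᴹ (r ℕ.+ d)
        X i = Y (i ↑ˡ e)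

        f : Vector L.Carrier r → Vector Carrierᴹ (suc r)
        f u = graph L.commutativeRing V u (X ∘ (_↑ˡ d))

        F : Vector L.Carrier r → Vector Carrierᴹ (suc (r ℕ.+ d))
        F u = graph L.commutativeRing V (u ++ const L.0#) X

      Y-elim : (Q : Carrierᴹ → Set p) → (∀ i → Q (X (i ↑ˡ d))) → (∀ i → Q (X (r ↑ʳ i))) →
               (∀ i → Q (Y ((r ℕ.+ d) ↑ʳ i))) → ∀ i → Q (Y i)
      Y-elim Q h₁ h₂ h₃ = Fin-+-elim (Q ∘ Y) (Fin-+-elim (Q ∘ X) h₁ h₂) h₃

      -- `P` is read by columns here: its rows express a multiple of `1∷ u′` by `1∷ u`, while the
      -- map goes the other way, expressing the images of `f u` by `f u′`.
      record Transfer (u u′ : Vector L.Carrier r) (P : Fin (suc r) → Vector K.Carrier (suc r)) :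
                      Set (cL ⊔ a ⊔ b) where
        field
          map          : Carrierᴹ → Carrierᴹ
          homomorphism : Homomorphism V V map
          map-f        : ∀ j → map (f u j) ≈ᴹ linearCombination VK (λ i → P i j) (f u′)
          fixes₁       : ∀ i → map (X (r ↑ʳ i)) ≈ᴹ X (r ↑ʳ i)
          fixes₂       : ∀ i → map (Y ((r ℕ.+ d) ↑ʳ i)) ≈ᴹ Y ((r ℕ.+ d) ↑ʳ i)
        open IsLeftModuleHomomorphism homomorphism public

      transfer : ∀ u u′ s P → (∀ i → s L.* (1∷ u′) i L.≈ linearCombination L/K (P i) (1∷ u)) →
                 Transfer u u′ P
      transfer u u′ s P su′≈Pu = record
        { map = g
        ; homomorphism = g-hom
        -- The extension prescribes only the images of basis vectors. That the first member of
        -- `f u`, a combination of them, also has the required image is `image-relation` solved for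
        -- `image zero`.
        ; map-f = λ
            { zero → begin
                g (linearCombination V u (X ∘ (_↑ˡ d)))   ≈⟨ lc-homo V V g-hom u _ ⟩
                linearCombination V u (λ i → g (X (i ↑ˡ d))) ≈⟨ lc-congˡ V u gX≈ ⟩
                linearCombination V u (λ i → L.- L.1# *ₗ image (suc i)) 
                  ≈⟨ lc-scale L.commutativeRing V (L.- L.1#) u (image ∘ suc) ⟩
                L.- L.1# *ₗ linearCombination V u (image ∘ suc)
                  ≈⟨ inverse⇒-1*ₗ L.commutativeRing V
                       (≈ᴹ-trans (+ᴹ-congʳ (≈ᴹ-sym (*ₗ-identityˡ (image zero)))) image-relation) ⟩
                image zero ∎
            ; (suc i) → begin
                g (L.- L.1# *ₗ X (i ↑ˡ d))                ≈⟨ g.*ₗ-homo _ _ ⟩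
                L.- L.1# *ₗ g (X (i ↑ˡ d))                ≈⟨ *ₗ-congˡ (gX≈ i) ⟩
                L.- L.1# *ₗ L.- L.1# *ₗ image (suc i)     ≈⟨ negate-twice L.commutativeRing V _ ⟩
                image (suc i)                             ∎
            }
        ; fixes₁ = λ i → ≈ᴹ-trans (gY≈Z ((r ↑ʳ i) ↑ˡ e)) (≈ᴹ-reflexive
            (≡.trans (lookup-++ˡ _ (λ j → Y ((r ℕ.+ d) ↑ʳ j)) (r ↑ʳ i))
                     (lookup-++ʳ Z₁ (λ j → X (r ↑ʳ j)) i)))
        ; fixes₂ = λ i → ≈ᴹ-trans (gY≈Z ((r ℕ.+ d) ↑ʳ i)) (≈ᴹ-reflexive
            (lookup-++ʳ (Z₁ ++ (λ j → X (r ↑ʳ j))) (λ j → Y ((r ℕ.+ d) ↑ʳ j)) i))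
        }
        where
        open ≈-Reasoning ≈ᴹ-setoid

        image : Fin (suc r) → Carrierᴹ
        image j = linearCombination VK (λ i → P i j) (f u′)

        -- The sign compensates for `f u` containing the negatives of the basis vectors.
        Z₁ : Vector Carrierᴹ r
        Z₁ i = L.- L.1# *ₗ image (suc i)

        extension = extend-linearly V basis
          ((Z₁ ++ (λ j → X (r ↑ʳ j))) ++ (λ j → Y ((r ℕ.+ d) ↑ʳ j)))
        g = proj₁ extension
        g-hom = proj₁ (proj₂ extension)
        gY≈Z = proj₂ (proj₂ extension)
        module g = IsLeftModuleHomomorphism g-hom

        gX≈ : ∀ i → g (X (i ↑ˡ d)) ≈ᴹ L.- L.1# *ₗ image (suc i)
        gX≈ i = ≈ᴹ-trans (gY≈Z ((i ↑ˡ d) ↑ˡ e)) (≈ᴹ-reflexive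
          (≡.trans (lookup-++ˡ _ (λ j → Y ((r ℕ.+ d) ↑ʳ j)) (i ↑ˡ d))
                   (lookup-++ˡ Z₁ (λ j → X (r ↑ʳ j)) i)))

        -- Collecting the coefficients of `f u′` gives P(1, u) = s(1, u′), a multiple of the
        -- relation of `f u′`.
        image-relation : linearCombination V (1∷ u) image ≈ᴹ 0ᴹ
        image-relation = begin
          linearCombination V (1∷ u) image
            ≈⟨ lc-· V (1∷ u) (λ j i → ι (P i j)) (f u′) ⟩
          linearCombination V ((1∷ u) L.· (λ j i → ι (P i j))) (f u′)
            ≈⟨ lc-congʳ V (f u′) (λ i → L.trans (lc-comm (1∷ u) (P i)) (L.sym (su′≈Pu i))) ⟩
          linearCombination V (λ i → s L.* (1∷ u′) i) (f u′)
            ≈⟨ lc-*ₗ V s (1∷ u′) (f u′) ⟨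
          s *ₗ linearCombination V (1∷ u′) (f u′)
            ≈⟨ *ₗ-congˡ (graph-relation L.commutativeRing V u′ (X ∘ (_↑ˡ d))) ⟩
          s *ₗ 0ᴹ
            ≈⟨ *ₗ-zeroʳ s ⟩
          0ᴹ ∎

      module _ {u u′ P} (G : Transfer u u′ P) where
        private
          module G = Transfer G

        restrict : Homomorphism VK VK G.map
        restrict = mkHomomorphism VK VK G.⟦⟧-cong G.+ᴹ-homo (G.*ₗ-homo ∘ ι)

        -- The entries of `P` lie in K, so `f u` goes into the K-span of `f u′`; the remaining
        -- generators are fixed.
        Transfer-Span : ∀ {v} → v ∈ Span VK (F u) → G.map v ∈ Span VK (F u′)
        Transfer-Span = Span-homo VK VK restrict (F u) (F u′) λ
          { zero → Span-resp-≈ VK (F u′) (G.⟦⟧-cong (≈ᴹ-sym (lc-++-zero V u X))) (map-f∈ zero)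
          ; (suc i) → Fin-+-elim (λ i → G.map (F u (suc i)) ∈ Span VK (F u′))
              (map-f∈ ∘ suc)
              (λ i → Span-resp-≈ VK (F u′)
                (≈ᴹ-sym (≈ᴹ-trans (G.*ₗ-homo _ _) (*ₗ-congˡ (G.fixes₁ i))))
                (unit∈Span VK (F u′) (suc (r ↑ʳ i))))
              i
          }
          where
          map-f∈ : ∀ j → G.map (f u j) ∈ Span VK (F u′)
          map-f∈ j = Span-⊆ VK (f u′) (F u′)
            (λ { zero → Span-resp-≈ VK (F u′) (lc-++-zero V u′ X) (unit∈Span VK (F u′) zero)
               ; (suc i) → unit∈Span VK (F u′) (suc (i ↑ˡ d)) })
            ((λ i → P i j) , G.map-f j)

      -- On `f u` the composite acts by the transpose of P′P, which is the identity. The first r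
      -- basis vectors are negatives of members of `f u`, and the others are fixed by both maps.
      Transfer-inverse : ∀ {u u′ P P′} (G : Transfer u u′ P) (H : Transfer u′ u P′) →
                         (∀ k j → (P′ k K.· P) j K.≈ K.unit k j) →
                         ∀ i → Transfer.map H (Transfer.map G (Y i)) ≈ᴹ Y i
      Transfer-inverse {u} {u′} {P} {P′} G H P′P≈unit = Y-elim (λ v → H.map (G.map v) ≈ᴹ v)
        (λ i → begin
          H.map (G.map (X (i ↑ˡ d)))
            ≈⟨ H.⟦⟧-cong (G.⟦⟧-cong (negate-twice L.commutativeRing V (X (i ↑ˡ d)))) ⟨
          H.map (G.map (L.- L.1# *ₗ f u (suc i)))
            ≈⟨ H.⟦⟧-cong (G.*ₗ-homo _ _) ⟩
          H.map (L.- L.1# *ₗ G.map (f u (suc i)))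
            ≈⟨ H.*ₗ-homo _ _ ⟩
          L.- L.1# *ₗ H.map (G.map (f u (suc i)))
            ≈⟨ *ₗ-congˡ (HG-f (suc i)) ⟩
          L.- L.1# *ₗ f u (suc i)
            ≈⟨ negate-twice L.commutativeRing V (X (i ↑ˡ d)) ⟩
          X (i ↑ˡ d) ∎)
        (λ i → ≈ᴹ-trans (H.⟦⟧-cong (G.fixes₁ i)) (H.fixes₁ i))
        (λ i → ≈ᴹ-trans (H.⟦⟧-cong (G.fixes₂ i)) (H.fixes₂ i))
        where
        module G = Transfer G
        module H = Transfer H
        open ≈-Reasoning ≈ᴹ-setoid

        HG-f : ∀ j → H.map (G.map (f u j)) ≈ᴹ f u j
        HG-f j = begin
          H.map (G.map (f u j))
            ≈⟨ H.⟦⟧-cong (G.map-f j) ⟩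
          H.map (linearCombination VK (λ i → P i j) (f u′))
            ≈⟨ lc-homo V V H.homomorphism (λ i → ι (P i j)) (f u′) ⟩
          linearCombination VK (λ i → P i j) (H.map ∘ f u′)
            ≈⟨ lc-congˡ VK (λ i → P i j) H.map-f ⟩
          linearCombination VK (λ i → P i j) (λ i → linearCombination VK (λ k → P′ k i) (f u))
            ≈⟨ lc-· VK (λ i → P i j) (λ i k → P′ k i) (f u) ⟩
          linearCombination VK ((λ i → P i j) K.· (λ i k → P′ k i)) (f u)
            ≈⟨ lc-congʳ VK (f u) (λ k → K.trans
                 (sum-cong-≋ K.+-commutativeMonoid (λ i → K.*-comm (P i j) (P′ k i)))
                 (K.trans (P′P≈unit k j) (K.reflexive (K.unit-sym k j)))) ⟩
          linearCombination VK (K.unit j) (f u)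
            ≈⟨ lc-unit VK j (f u) ⟩
          f u j ∎

      Singer-orbit⇒GL-orbit : ∀ {u u′} →
        LinearlyIndependent L/K (1∷ u) → LinearlyIndependent L/K (1∷ u′) →
        Span L/K (1∷ u′) ∈ Orbit L.setoid (SingerCycle L) (Span L/K (1∷ u)) →
        Span VK (F u′) ∈ Orbit ≈ᴹ-setoid (GL V) (Span VK (F u))
      Singer-orbit⇒GL-orbit {u} {u′} u-indep u′-indep (h , (s , s#0 , h≈s*) , hu⊆u′ , u′⊆hu) =
        G.map , proj₁ GL-G
        , (λ (v , v∈ , y≈Gv) → Span-resp-≈ VK (F u′) (≈ᴹ-sym y≈Gv) (Transfer-Span G v∈))
        , λ {y} y∈ → H.map y , Transfer-Span H y∈ , ≈ᴹ-sym (proj₂ GL-G y)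
        where
        t = proj₁ (#0⇒inverse s#0)
        ts≈1 = proj₂ (#0⇒inverse s#0)

        su∈ : ∀ i → s L.* (1∷ u) i ∈ Span L/K (1∷ u′)
        su∈ i = hu⊆u′ ((1∷ u) i , unit∈Span L/K (1∷ u) i , L.sym (h≈s* _))

        tu′∈ : ∀ i → t L.* (1∷ u′) i ∈ Span L/K (1∷ u)
        tu′∈ i with u′⊆hu (unit∈Span L/K (1∷ u′) i)
        ... | x , x∈ , u′≈hx = Span-resp-≈ L/K (1∷ u) (L.sym (begin
          t L.* (1∷ u′) i ≈⟨ L.*-congˡ (L.trans u′≈hx (h≈s* x)) ⟩
          t L.* (s L.* x) ≈⟨ L.*-assoc t s x ⟨
          t L.* s L.* x   ≈⟨ L.*-congʳ ts≈1 ⟩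
          L.1# L.* x      ≈⟨ L.*-identityˡ x ⟩
          x               ∎)) x∈
          where open ≈-Reasoning L.setoid

        P P′ : Fin (suc r) → Vector K.Carrier (suc r)
        P  = proj₁ ∘ tu′∈
        P′ = proj₁ ∘ su∈

        -- Substitution gives v = t(sv) = P′Pv for the extended vectors, and coordinates over K are
        -- unique. Stated for general `v`, `v′`, since it is applied in both directions.
        inverse-matrices : ∀ {v v′ : Vector L.Carrier r} {s t} → t L.* s L.≈ L.1# →
          LinearlyIndependent L/K (1∷ v) →
          (su∈ : ∀ i → s L.* (1∷ v) i ∈ Span L/K (1∷ v′)) →
          (tu′∈ : ∀ i → t L.* (1∷ v′) i ∈ Span L/K (1∷ v)) →
          ∀ k j → (proj₁ (su∈ k) K.· (proj₁ ∘ tu′∈)) j K.≈ K.unit k j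
        inverse-matrices {v} {v′} {s} {t} ts≈1 v-indep su∈ tu′∈ k =
          independent⇒unique L/K {v = 1∷ v} v-indep (begin
          linearCombination L/K (proj₁ (su∈ k) K.· (proj₁ ∘ tu′∈)) (1∷ v)
            ≈⟨ lc-· L/K (proj₁ (su∈ k)) (proj₁ ∘ tu′∈) (1∷ v) ⟨
          linearCombination L/K (proj₁ (su∈ k)) (λ i → linearCombination L/K (proj₁ (tu′∈ i)) (1∷ v))
            ≈⟨ lc-congˡ L/K (proj₁ (su∈ k)) (proj₂ ∘ tu′∈) ⟨
          linearCombination L/K (proj₁ (su∈ k)) (λ i → t L.* (1∷ v′) i)
            ≈⟨ lc-homo L/K L/K (scaling-homomorphism t) (proj₁ (su∈ k)) (1∷ v′) ⟨
          t L.* linearCombination L/K (proj₁ (su∈ k)) (1∷ v′)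
            ≈⟨ L.*-congˡ (proj₂ (su∈ k)) ⟨
          t L.* (s L.* (1∷ v) k) ≈⟨ L.*-assoc t s _ ⟨
          t L.* s L.* (1∷ v) k   ≈⟨ L.*-congʳ ts≈1 ⟩
          L.1# L.* (1∷ v) k      ≈⟨ L.*-identityˡ _ ⟩
          (1∷ v) k               ≈⟨ lc-unit L/K k (1∷ v) ⟨
          linearCombination L/K (K.unit k) (1∷ v) ∎)
          where open ≈-Reasoning L.setoid

        G : Transfer u u′ P
        G = transfer u u′ t P (proj₂ ∘ tu′∈)
        module G = Transfer G

        H : Transfer u′ u P′
        H = transfer u′ u s P′ (proj₂ ∘ su∈)
        module H = Transfer H

        GL-G : G.map ∈ GL V × (∀ v → G.map (H.map v) ≈ᴹ v)
        GL-G = inverse-on-basis⇒GL V basis G.homomorphism H.homomorphism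
          (Transfer-inverse G H (inverse-matrices {v′ = u′} ts≈1 u-indep su∈ tu′∈))
          (Transfer-inverse H G (inverse-matrices {v′ = u} (L.trans (L.*-comm s t) ts≈1) u′-indep tu′∈ su∈))

    -- The subspace `T` as the span of a padded `graph`

    Span-++-cong : ∀ {X X′ : Vector Carrierᴹ n} {w w′} → (∀ i → X i ≡ X′ i) → w ≈ᴹ w′ →
                   Span VK (X ++ (w ∷ [])) ≐ Span VK (X′ ++ (w′ ∷ []))
    Span-++-cong {n} {X} {X′} {w} {w′} X≡X′ w≈w′ =
        Span-⊆ VK v v′ (λ i → Span-resp-≈ VK v′ (≈ᴹ-sym (v≈v′ i)) (unit∈Span VK v′ i))
      , Span-⊆ VK v′ v (λ i → Span-resp-≈ VK v (v≈v′ i) (unit∈Span VK v i))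
      where
      v v′ : Vector Carrierᴹ (n ℕ.+ 1)
      v  = X ++ (w ∷ [])
      v′ = X′ ++ (w′ ∷ [])
      v≈v′ : ∀ i → v i ≈ᴹ v′ i
      v≈v′ i with splitAt n i
      ... | inj₁ j    = ≈ᴹ-reflexive (X≡X′ j)
      ... | inj₂ zero = w≈w′

    -- With the lengths written as sums, each `inject≤` in `T` is a left inclusion `_↑ˡ_`, so
    -- `Span-graph` applies.
    T-≐ : ∀ {r d e} (Y : Vector Carrierᴹ (r ℕ.+ d ℕ.+ e)) k≤m+1 r≤k∸1 (u : Vector L.Carrier r) →
          T V Y {k = suc (r ℕ.+ d)} k≤m+1 r≤k∸1 u ≐
          Span VK (graph L.commutativeRing V (u ++ const L.0#) (Y ∘ (_↑ˡ e)))
    T-≐ {r} {d} {e} Y k≤m+1 r≤k∸1 u = ≐-trans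
      (Span-++-cong (λ i → ≡.cong Y (inject≤-↑ˡ i _))
        (lc-congˡ V u (λ i → ≈ᴹ-reflexive (≡.cong Y
          (≡.trans (inject≤-↑ˡ (inject≤ i r≤k∸1) _) (≡.cong (_↑ˡ e) (inject≤-↑ˡ i r≤k∸1)))))))
      (Span-graph (Y ∘ (_↑ˡ e)) u)

  -- Removes the padding that the passage from the GL-orbit leaves on both vectors: zeros add
  -- nothing to a span.
  Span-1∷++ : ∀ {r} d (u : Vector L.Carrier r) →
              Span L/K (1∷ (u ++ const {B = Fin d} L.0#)) ≐ Span L/K (1∷ u)
  Span-1∷++ {r} d u =
    Span-⊆ L/K (1∷ ũ) (1∷ u) (λ
      { zero → unit∈Span L/K (1∷ u) zero
      ; (suc i) → Fin-+-elim (λ i → ũ i ∈ Span L/K (1∷ u))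
          (λ i → ≡.subst (_∈ Span L/K (1∷ u)) (≡.sym (lookup-++ˡ u _ i)) (unit∈Span L/K (1∷ u) (suc i)))
          (λ j → ≡.subst (_∈ Span L/K (1∷ u)) (≡.sym (lookup-++ʳ u (const {B = Fin d} L.0#) j))
            (const K.0# , L.sym (lc-zero L/K (1∷ u))))
          i })
    , Span-⊆ L/K (1∷ u) (1∷ ũ) (λ
      { zero → unit∈Span L/K (1∷ ũ) zero
      ; (suc i) → ≡.subst (_∈ Span L/K (1∷ ũ)) (lookup-++ˡ u _ i) (unit∈Span L/K (1∷ ũ) (suc (i ↑ˡ d))) })
    where
    ũ : Vector L.Carrier (r ℕ.+ d)
    ũ = u ++ const L.0#

-- Both directions for `T`, with k - 1 and m written as sums

open import Data.Nat.Base using (_+_)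

lemma3p2 :
  ∀ {cK ℓK₁ ℓK₂ cL ℓL₁ ℓL₂ cV ℓV : Level} (q m l k r : ℕ) →
  IsPrimePower q →
  3 ≤ k → (k≤min : k ≤ (m + 1) ⊓ l) →
  1 ≤ r → (r≤k∸1 : r ≤ k ∸ 1) →
  (K : FiniteField q cK ℓK₁ ℓK₂) (L : FiniteField (q ^ l) cL ℓL₁ ℓL₂)
  (ι : FiniteField.Carrier K → FiniteField.Carrier L)
  (ι-homo : RingMorphisms.IsRingHomomorphism
              (FiniteField.rawRing K) (FiniteField.rawRing L) ι)
  (V : LeftModule (FiniteField.ring L) cV ℓV)
  (Y : Vector (LeftModule.Carrierᴹ V) m) → IsBasis V Y →
  (u u′ : Vector (FiniteField.Carrier L) r) →
  let open Over K L ι ι-homo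
      k≤m+1 = m≤n⊓o⇒m≤n (m + 1) l k≤min
  in
  LinearlyIndependent L/K (1∷ u) →
  LinearlyIndependent L/K (1∷ u′) →
  (T V Y k≤m+1 r≤k∸1 u′ ∈ Orbit (LeftModule.≈ᴹ-setoid V) (GL V) (T V Y k≤m+1 r≤k∸1 u))
    ⇔
  (Span L/K (1∷ u′) ∈ Orbit (FiniteField.setoid L) (SingerCycle L) (Span L/K (1∷ u)))
lemma3p2 q m l (suc n) (suc r) _ (s≤s _) k≤min (s≤s _) r≤n K L ι ι-homo V Y basis u u′ u-indep u′-indep
  -- The differences `d` and `e` give k - 1 = suc r + d and m = suc r + d + e, the block lengths of
  -- the basis.
  with m≤n⇒∃[o]m+o≡n r≤n
... | d , ≡.refl
  with m≤n⇒∃[o]m+o≡n (m≤n+o⇒m∸n≤o (suc n) 1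
         (≤-trans (m≤n⊓o⇒m≤n (m + 1) l k≤min) (≤-reflexive (+-comm m 1))))
... | e , ≡.refl = mk⇔
  (λ T∈ → Orbit-resp-≐ L.setoid (Span-1∷++ᴷ d u) (Span-1∷++ᴷ d u′)
    (GL-orbit⇒Singer-orbit K L ι ι-homo V {X = Y ∘ (_↑ˡ e)} X-indep (u ++ const L.0#) (u′ ++ const L.0#)
      (graph-K-independent K L ι ι-homo V (Y ∘ (_↑ˡ e)) X-indep u′ u′-indep)
      (Orbit-resp-≐ (LeftModule.≈ᴹ-setoid V) (T≐ u) (T≐ u′) T∈)))
  (λ S∈ → Orbit-resp-≐ (LeftModule.≈ᴹ-setoid V) (≐-sym (T≐ u)) (≐-sym (T≐ u′))
    (Singer-orbit⇒GL-orbit K L ι ι-homo V {Y = Y} basis u-indep u′-indep S∈))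
  where
  module L = FiniteField L
  X-indep = independent-↑ˡ V {v = Y} (proj₁ basis)
  Span-1∷++ᴷ = Span-1∷++ K L ι ι-homo
  T≐ = T-≐ K L ι ι-homo V Y (m≤n⊓o⇒m≤n (suc r + d + e + 1) l k≤min) r≤n
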